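{- Let $k, t \ge 2$ be integers. If $\ell$ is sufficiently large (that is, there is $\ell_0 = \ell_0(k,t)$ such that for all integers $\ell \ge \ell_0$), then $$ggr_{k,\ell}(S_t) = 2k(t-1)+1.$$
   Context: $S_t$ denotes the star with $t$ edges, i.e. $S_t = K_{1,t}$. All colorings are colorings of the edges of complete graphs. A colored complete graph has a nontrivial $G_k$-partition if there is a partition of its vertices into at least two (nonempty) parts such that at most $k$ colors in total appear on the edges between different parts. A colored complete graph is $k$-Gallai if every nontrivial induced subgraph (i.e. every induced subgraph on at least two vertices) has a nontrivial $G_k$-partition. For positive integers $k,\ell$ and a graph $H$, the generalized $(k,\ell)$ Gallai-Ramsey number $ggr_{k,\ell}(H)$ is the minimum $N$ such that every $k$-Gallai coloring of $K_n$ with $n \ge N$ using at most $\ell$ colors contains a monochromatic copy of $H$ (as a not necessarily induced subgraph). -}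

module Defs where

open import Data.Nat using (ℕ; suc; _≤_)
open import Data.Fin using (Fin; zero)
open import Data.Fin.Subset using (Subset; _∈_; ∣_∣)
open import Data.Product using (_×_; _,_; ∃; ∃-syntax)
open import Data.Sum using (_⊎_; inj₁; inj₂)
open import Function.Definitions using (Injective)
open import Relation.Binary.Definitions using (Symmetric; Irreflexive)
open import Relation.Binary.PropositionalEquality using (_≡_; _≢_; refl)

record SimpleGraph : Set₁ where
  field
    order  : ℕ
    Adj    : Fin order → Fin order → Set
    sym    : Symmetric Adj
    irrefl : Irreflexive _≡_ Adj

-- K_{1,t}, with centre `zero`.
Star : ℕ → SimpleGraph
Star t = record
  { order  = suc t
  ; Adj    = λ i j → (i ≡ zero × j ≢ zero) ⊎ (i ≢ zero × j ≡ zero)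
  ; sym    = λ { (inj₁ (p , q)) → inj₂ (q , p) ; (inj₂ (p , q)) → inj₁ (q , p) }
  ; irrefl = λ { refl (inj₁ (p , q)) → q p ; refl (inj₂ (p , q)) → p q }
  }

-- Edge colorings of K_n with at most ℓ colors.  The diagonal values
-- `color v v` carry no meaning: every notion below only inspects `color`
-- at pairs of distinct vertices.
record Coloring (n ℓ : ℕ) : Set where
  field
    color     : Fin n → Fin n → Fin ℓ
    color-sym : ∀ u v → color u v ≡ color v u

open Coloring public

-- A nontrivial G_k-partition of the subgraph induced on S, given by the map
-- `part` sending a vertex to the index of its part (arbitrary outside S).
-- C contains all the colors that appear between different parts.
HasNontrivialPartition : ∀ {n ℓ} → ℕ → Coloring n ℓ → Subset n → Set
HasNontrivialPartition {n} {ℓ} k c S =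
  ∃[ m ] ∃ λ (part : Fin n → Fin m) →
    2 ≤ m
    × (∀ i → ∃[ v ] v ∈ S × part v ≡ i)
    × (∃ λ (C : Subset ℓ) →
         ∣ C ∣ ≤ k
         × (∀ u v → u ∈ S → v ∈ S → part u ≢ part v → color c u v ∈ C))

IsGallai : ∀ {n ℓ} → ℕ → Coloring n ℓ → Set
IsGallai {n} k c = (S : Subset n) → 2 ≤ ∣ S ∣ → HasNontrivialPartition k c S

HasMonochromaticCopy : ∀ {n ℓ} → SimpleGraph → Coloring n ℓ → Set
HasMonochromaticCopy {n} {ℓ} H c =
  ∃ λ (x : Fin ℓ) → ∃ λ (f : Fin order → Fin n) →
    Injective _≡_ _≡_ f × (∀ i j → Adj i j → color c (f i) (f j) ≡ x)
  where open SimpleGraph H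

Forces : ℕ → ℕ → SimpleGraph → ℕ → Set
Forces k ℓ H N =
  ∀ n → N ≤ n → (c : Coloring n ℓ) → IsGallai k c → HasMonochromaticCopy H c

-- ggr_{k,ℓ}(H) = N, as a relation: N is the minimum of the forcing numbers.
IsGGR : ℕ → ℕ → SimpleGraph → ℕ → Set
IsGGR k ℓ H N = Forces k ℓ H N × (∀ M → Forces k ℓ H M → N ≤ M)

{-# OPTIONS --safe #-}
module Submission where

-- Let d = t ∸ 1.  In a coloring without a monochromatic S_t every color has
-- degree at most d at every vertex.  If at most k colors appear between the
-- two sides of a bipartition, a vertex has at most k * d neighbors across, so
-- both sides have at most k * d vertices and n ≤ 2 * k * d.
--
-- Conversely, split 2 * k * d vertices into two sides, each consisting of k
-- classes of size d.  Between the sides, a Latin square on the classes splits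
-- the edges into k d-regular color classes.  Inside a side, the edge from u to
-- a later vertex v gets a color determined by u and the class of v: for each u
-- this uses k fresh colors, each on at most d edges.  A vertex set meeting both
-- sides is partitioned by the sides, any other one by splitting off its least
-- vertex.

open import Data.Nat using (ℕ; zero; suc; _+_; _*_; _∸_; _≤_; _<_; z≤n; s≤s; NonZero)
import Data.Nat.Properties as ℕ
open import Data.Nat.DivMod using (_%_; m%n<n; m<n⇒m%n≡m; [m+n]%n≡m%n; %-distribˡ-+)
open import Data.Fin as Fin using (Fin; zero; suc; toℕ; fromℕ<; inject≤; combine; remQuot)
import Data.Fin.Properties as Fin
open import Data.Fin.Subset using (Subset; inside; outside; _∈_; ∣_∣; ⊤; ⊥; ⁅_⁆; _∪_; _-_; Nonempty)
import Data.Fin.Subset.Properties as Subset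
open import Data.List using (List; []; _∷_; length; filter; lookup; allFin)
open import Data.List.Properties using (length-tabulate)
open import Data.List.Membership.Propositional using () renaming (_∈_ to _∈ₗ_)
open import Data.List.Membership.Propositional.Properties using (∈-filter⁻; ∈-lookup)
open import Data.List.Relation.Unary.All as All using ()
open import Data.List.Relation.Unary.AllPairs using (_∷_)
open import Data.List.Relation.Unary.Any using (here)
open import Data.List.Relation.Unary.Unique.Propositional using (Unique)
open import Data.List.Relation.Unary.Unique.Propositional.Properties using (filter⁺; allFin⁺)
open import Data.Product using (_×_; _,_; ∃-syntax; ∃₂; proj₁; proj₂)
open import Data.Product.Properties using (,-injectiveˡ; ,-injectiveʳ)
open import Data.Sum using (inj₁; inj₂)
open import Data.Vec using ([]; _∷_; here; there)
open import Function using (_∘_)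
open import Function.Definitions using (Injective)
open import Relation.Binary.Definitions using (Tri; tri<; tri≈; tri>)
open import Relation.Binary.PropositionalEquality
  using (_≡_; _≢_; refl; sym; trans; cong; cong₂; subst; module ≡-Reasoning)
open import Relation.Nullary using (¬_; Dec; yes; no; contradiction)
open import Relation.Nullary.Decidable using (¬?; _×-dec_)
open import Relation.Unary using (Decidable)
open import Defs

-- Pigeonhole on duplicate-free lists, and stars obtained from it.

lookup-injective : ∀ {A : Set} {xs : List A} → Unique xs →
                   Injective _≡_ _≡_ (lookup xs)
lookup-injective (_  ∷ _)  {zero}  {zero}  _  = refl
lookup-injective (x∉ ∷ _)  {zero}  {suc j} eq = contradiction eq (All.lookup x∉ (∈-lookup j))
lookup-injective (x∉ ∷ _)  {suc i} {zero}  eq = contradiction (sym eq) (All.lookup x∉ (∈-lookup i))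
lookup-injective (_  ∷ xs) {suc i} {suc j} eq = cong suc (lookup-injective xs eq)

length-filter-¬ : ∀ {A : Set} {P : A → Set} (P? : Decidable P) xs →
                  length xs ≡ length (filter P? xs) + length (filter (¬? ∘ P?) xs)
length-filter-¬ P? [] = refl
length-filter-¬ P? (x ∷ xs) with P? x
... | yes _ = cong suc (length-filter-¬ P? xs)
... | no  _ = trans (cong suc (length-filter-¬ P? xs)) (sym (ℕ.+-suc _ _))

+-<-split : ∀ a b {m n} → a + b < m + n → ¬ a < m → b < n
+-<-split a b {m} {n} ab<mn a≮m = ℕ.+-cancelˡ-< m b n
  (ℕ.≤-<-trans (ℕ.+-monoˡ-≤ b (ℕ.≮⇒≥ a≮m)) ab<mn)

-- Induction on the bound for `∣ C ∣`: either the value at the head is taken more than `d` times, or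
-- deleting it from `C` and its at most `d` entries from the list leaves a longer than allowed list
-- for the smaller set.
pigeonhole-list : ∀ {A : Set} {ℓ} (g : A → Fin ℓ) d k (C : Subset ℓ) xs → Unique xs →
                  ∣ C ∣ ≤ k → (∀ {x} → x ∈ₗ xs → g x ∈ C) → k * d < length xs →
                  ∃₂ λ y ys → Unique ys × d < length ys × (∀ {x} → x ∈ₗ ys → x ∈ₗ xs × g x ≡ y)
pigeonhole-list g d zero C (x ∷ xs) _ ∣C∣≤0 g∈C _ =
  contradiction (ℕ.<-≤-trans (Subset.x∈p⇒∣p-x∣<∣p∣ (g∈C (here refl))) ∣C∣≤0) λ ()
pigeonhole-list g d (suc k) C xs@(x ∷ _) uniq ∣C∣≤k g∈C kd< = go (d ℕ.<? length (filter P? xs))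
  where
  P? : Decidable (λ z → g z ≡ g x)
  P? z = g z Fin.≟ g x

  go : Dec (d < length (filter P? xs)) →
       ∃₂ λ y ys → Unique ys × d < length ys × (∀ {z} → z ∈ₗ ys → z ∈ₗ xs × g z ≡ y)
  go (yes d<) = g x , filter P? xs , filter⁺ P? uniq , d< , ∈-filter⁻ P? {xs = xs}
  go (no d≮)
    with y , ys , u , d< , h ← pigeonhole-list g d k (C - g x) (filter (¬? ∘ P?) xs)
           (filter⁺ (¬? ∘ P?) uniq)
           (ℕ.≤-pred (ℕ.≤-trans (Subset.x∈p⇒∣p-x∣<∣p∣ (g∈C (here refl))) ∣C∣≤k))
           (λ z∈ → let z∈xs , gz≢ = ∈-filter⁻ (¬? ∘ P?) {xs = xs} z∈ in
                   Subset.x∈p∧x≢y⇒x∈p-y (g∈C z∈xs) gz≢)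
           (+-<-split d (k * d) (subst (d + k * d <_) (length-filter-¬ P? xs) kd<) d≮)
    = y , ys , u , d< , λ z∈ → let z∈f , eq = h z∈ in
                               proj₁ (∈-filter⁻ (¬? ∘ P?) {xs = xs} z∈f) , eq

-- The pigeonhole applied to `color c v` yields more than `d` vertices of `xs` joined to `v` in one
-- color. The first `suc d` of them become the leaves, distinct because the list has no repetitions.
monochromatic-star : ∀ {n ℓ d} k (c : Coloring n ℓ) (C : Subset ℓ) v xs → Unique xs →
                     ∣ C ∣ ≤ k → (∀ {x} → x ∈ₗ xs → v ≢ x) →
                     (∀ {x} → x ∈ₗ xs → color c v x ∈ C) →
                     k * d < length xs → HasMonochromaticCopy (Star (suc d)) c
monochromatic-star {n} {d = d} k c C v xs uniq ∣C∣≤k v≢ v∈C kd<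
  with y , ys , u , d< , h ← pigeonhole-list (color c v) d k C xs uniq ∣C∣≤k v∈C kd<
  = y , f , inj , mono
  where
  leaf : Fin (suc d) → Fin n
  leaf j = lookup ys (inject≤ j d<)

  f : Fin (suc (suc d)) → Fin n
  f zero    = v
  f (suc j) = leaf j

  leaf-prop : ∀ j → leaf j ∈ₗ xs × color c v (leaf j) ≡ y
  leaf-prop j = h (∈-lookup (inject≤ j d<))

  inj : Injective _≡_ _≡_ f
  inj {zero}  {zero}  _  = refl
  inj {zero}  {suc j} eq = contradiction eq (v≢ (proj₁ (leaf-prop j)))
  inj {suc i} {zero}  eq = contradiction (sym eq) (v≢ (proj₁ (leaf-prop i)))
  inj {suc i} {suc j} eq =
    cong suc (Fin.inject≤-injective d< d< i j (lookup-injective u eq))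

  mono : ∀ i j → SimpleGraph.Adj (Star (suc d)) i j → color c (f i) (f j) ≡ y
  mono _       zero    (inj₁ (_ , j≢0))    = contradiction refl j≢0
  mono zero    (suc j) (inj₁ _)            = proj₂ (leaf-prop j)
  mono zero    _       (inj₂ (i≢0 , _))    = contradiction refl i≢0
  mono (suc i) zero    (inj₂ _)            = trans (color-sym c _ _) (proj₂ (leaf-prop i))

-- The upper bound.

forces-star : ∀ k d ℓ → 1 ≤ k → 1 ≤ d → Forces k ℓ (Star (suc d)) (2 * k * d + 1)
forces-star k d ℓ 1≤k 1≤d n N≤n c gallai
  -- `1 ≤ k` and `1 ≤ d` give `2 ≤ n`, so the Gallai property applies to the whole vertex set.
  with gallai ⊤ (subst (2 ≤_) (sym (Subset.∣⊤∣≡n n))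
         (ℕ.≤-trans (ℕ.+-monoˡ-≤ 1 (ℕ.*-mono-≤ (ℕ.≤-trans 1≤k (ℕ.m≤m+n k _)) 1≤d)) N≤n))
... | suc zero , _ , s≤s () , _
... | suc (suc m) , part , _ , onto , C , ∣C∣≤k , cross
  with a , _ , pa ← onto zero | b , _ , pb ← onto (suc zero)
  -- All parts other than `zero` are merged. One of the two resulting sides has more than `k * d`
  -- vertices, and a vertex of the other side, `b` or `a`, becomes the centre.
  = go (k * d ℕ.<? length (filter P? (allFin n)))
  where
  P? : Decidable (λ v → part v ≡ zero)
  P? v = part v Fin.≟ zero

  star : ∀ v xs → Unique xs → (∀ {x} → x ∈ₗ xs → part v ≢ part x) →
         k * d < length xs → HasMonochromaticCopy (Star (suc d)) c
  star v xs uniq v≁ = monochromatic-star k c C v xs uniq ∣C∣≤k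
    (λ x∈ v≡x → v≁ x∈ (cong part v≡x))
    (λ x∈ → cross v _ Subset.∈⊤ Subset.∈⊤ (v≁ x∈))

  kd+kd<n : k * d + k * d < length (allFin n)
  kd+kd<n = begin-strict
    k * d + k * d       ≡⟨ ℕ.*-distribʳ-+ d k k ⟨
    (k + k) * d         ≡⟨ cong (λ j → (k + j) * d) (ℕ.+-identityʳ k) ⟨
    2 * k * d           <⟨ ℕ.m<m+n (2 * k * d) (s≤s z≤n) ⟩
    2 * k * d + 1       ≤⟨ N≤n ⟩
    n                   ≡⟨ length-tabulate {n = n} (λ i → i) ⟨
    length (allFin n)   ∎
    where open ℕ.≤-Reasoning

  go : Dec (k * d < length (filter P? (allFin n))) → HasMonochromaticCopy (Star (suc d)) c
  go (yes kd<) = star b _ (filter⁺ P? (allFin⁺ n))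
    (λ x∈ eq → contradiction (trans (sym pb) (trans eq (proj₂ (∈-filter⁻ P? {xs = allFin n} x∈)))) λ ())
    kd<
  go (no kd≮) = star a _ (filter⁺ (¬? ∘ P?) (allFin⁺ n))
    (λ x∈ eq → proj₂ (∈-filter⁻ (¬? ∘ P?) {xs = allFin n} x∈) (trans (sym eq) pa))
    (+-<-split (k * d) (k * d) (subst (k * d + k * d <_) (length-filter-¬ P? (allFin n)) kd+kd<n) kd≮)

-- Small color sets, least vertices and two-part partitions.

∣p∪q∣≤∣p∣+∣q∣ : ∀ {n} (p q : Subset n) → ∣ p ∪ q ∣ ≤ ∣ p ∣ + ∣ q ∣
∣p∪q∣≤∣p∣+∣q∣ []            []            = z≤n
∣p∪q∣≤∣p∣+∣q∣ (outside ∷ p) (outside ∷ q) = ∣p∪q∣≤∣p∣+∣q∣ p q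
∣p∪q∣≤∣p∣+∣q∣ (outside ∷ p) (inside  ∷ q) =
  ℕ.≤-trans (s≤s (∣p∪q∣≤∣p∣+∣q∣ p q)) (ℕ.≤-reflexive (sym (ℕ.+-suc ∣ p ∣ ∣ q ∣)))
∣p∪q∣≤∣p∣+∣q∣ (inside  ∷ p) (outside ∷ q) = s≤s (∣p∪q∣≤∣p∣+∣q∣ p q)
∣p∪q∣≤∣p∣+∣q∣ (inside  ∷ p) (inside  ∷ q) =
  s≤s (ℕ.≤-trans (∣p∪q∣≤∣p∣+∣q∣ p q) (ℕ.+-monoʳ-≤ ∣ p ∣ (ℕ.n≤1+n ∣ q ∣)))

image : ∀ {k ℓ} → (Fin k → Fin ℓ) → Subset ℓ
image {zero}  g = ⊥
image {suc k} g = ⁅ g zero ⁆ ∪ image (g ∘ suc)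

∣image∣≤ : ∀ {k ℓ} (g : Fin k → Fin ℓ) → ∣ image g ∣ ≤ k
∣image∣≤ {zero}  {ℓ} g = ℕ.≤-reflexive (Subset.∣⊥∣≡0 ℓ)
∣image∣≤ {suc k}     g = ℕ.≤-trans (∣p∪q∣≤∣p∣+∣q∣ ⁅ g zero ⁆ (image (g ∘ suc)))
  (ℕ.+-mono-≤ (ℕ.≤-reflexive (Subset.∣⁅x⁆∣≡1 (g zero))) (∣image∣≤ (g ∘ suc)))

∈-image : ∀ {k ℓ} (g : Fin k → Fin ℓ) i → g i ∈ image g
∈-image g zero    = Subset.x∈p∪q⁺ (inj₁ (Subset.x∈⁅x⁆ (g zero)))
∈-image g (suc i) = Subset.x∈p∪q⁺ (inj₂ (∈-image (g ∘ suc) i))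

least : ∀ {n} (S : Subset n) → Nonempty S → ∃[ i ] i ∈ S × (∀ {j} → j ∈ S → i Fin.≤ j)
least (inside  ∷ S) _                     = zero , here , λ _ → z≤n
least (outside ∷ S) (suc i , there i∈S)
  with m , m∈S , m≤ ← least S (i , i∈S) = suc m , there m∈S , λ { (there j∈S) → s≤s (m≤ j∈S) }

Fin2-≢ : ∀ {x y z : Fin 2} → x ≢ y → x ≢ z → y ≡ z
Fin2-≢ {zero}     {zero}     x≢y _ = contradiction refl x≢y
Fin2-≢ {zero}     {suc zero} {zero}     _ x≢z = contradiction refl x≢z
Fin2-≢ {zero}     {suc zero} {suc zero} _ _ = refl
Fin2-≢ {suc zero} {suc zero} x≢y _ = contradiction refl x≢y
Fin2-≢ {suc zero} {zero}     {zero}     _ _ = refl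
Fin2-≢ {suc zero} {zero}     {suc zero} _ x≢z = contradiction refl x≢z

-- Common form of both partitions in the lower bound: `a` and `b` show that neither part is empty,
-- and `g`, being indexed by `Fin k`, lists at most `k` crossing colors.
bipartition : ∀ {n ℓ k} (c : Coloring n ℓ) {S : Subset n} (part : Fin n → Fin 2) {a b} →
              a ∈ S → b ∈ S → part a ≢ part b → (g : Fin k → Fin ℓ) →
              (∀ {u v} → u ∈ S → v ∈ S → part u ≢ part v → ∃[ j ] g j ≡ color c u v) →
              HasNontrivialPartition k c S
bipartition c part {a} {b} a∈S b∈S a≁b g cross =
  2 , part , ℕ.≤-refl , onto , image g , ∣image∣≤ g ,
  λ u v u∈S v∈S u≁v → let j , eq = cross u∈S v∈S u≁v in subst (_∈ image g) eq (∈-image g j)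
  where
  onto : ∀ i → ∃[ v ] v ∈ _ × part v ≡ i
  onto i with part a Fin.≟ i
  ... | yes eq  = a , a∈S , eq
  ... | no  a≁i = b , b∈S , Fin2-≢ a≁b a≁i

-- The cyclic Latin square.

module _ (k : ℕ) {{_ : NonZero k}} where

  -- The addition table of the integers modulo `k`.
  latin : Fin k → Fin k → Fin k
  latin i j = fromℕ< (m%n<n (toℕ i + toℕ j) k)

  latin-comm : ∀ i j → latin i j ≡ latin j i
  latin-comm i j = Fin.fromℕ<-cong _ _ (cong (_% k) (ℕ.+-comm (toℕ i) (toℕ j))) _ _

  -- Adding `h`, a representative of minus `i` modulo `k`, recovers `j` from `i + j`.
  latin-cancelˡ : ∀ i {j j′} → latin i j ≡ latin i j′ → j ≡ j′
  latin-cancelˡ i {j} {j′} eq = Fin.toℕ-injective (begin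
    toℕ j                                ≡⟨ recover j ⟩
    (h % k + (toℕ i + toℕ j)  % k) % k   ≡⟨ cong (λ r → (h % k + r) % k) (Fin.fromℕ<-injective _ _ _ _ eq) ⟩
    (h % k + (toℕ i + toℕ j′) % k) % k   ≡⟨ recover j′ ⟨
    toℕ j′                               ∎)
    where
    open ≡-Reasoning
    h : ℕ
    h = k ∸ toℕ i

    recover : ∀ j → toℕ j ≡ (h % k + (toℕ i + toℕ j) % k) % k
    recover j = begin
      toℕ j                                ≡⟨ m<n⇒m%n≡m (Fin.toℕ<n j) ⟨
      toℕ j % k                            ≡⟨ [m+n]%n≡m%n (toℕ j) k ⟨
      (toℕ j + k) % k                      ≡⟨ cong (_% k) (ℕ.+-comm (toℕ j) k) ⟩
      (k + toℕ j) % k                      ≡⟨ cong (λ m → (m + toℕ j) % k) (ℕ.m∸n+n≡m (ℕ.<⇒≤ (Fin.toℕ<n i))) ⟨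
      (h + toℕ i + toℕ j) % k              ≡⟨ cong (_% k) (ℕ.+-assoc h (toℕ i) (toℕ j)) ⟩
      (h + (toℕ i + toℕ j)) % k            ≡⟨ %-distribˡ-+ h (toℕ i + toℕ j) k ⟩
      (h % k + (toℕ i + toℕ j) % k) % k    ∎

-- The lower bound: the extremal coloring.

module Extremal (k d : ℕ) {{_ : NonZero k}} where

  n : ℕ
  n = 2 * k * d

  -- A vertex number is read in mixed radix as a triple of `side`, `class` and `index`.
  side : Fin n → Fin 2
  side v = proj₁ (remQuot {2} k (proj₁ (remQuot {2 * k} d v)))

  class : Fin n → Fin k
  class v = proj₂ (remQuot {2} k (proj₁ (remQuot {2 * k} d v)))

  index : Fin n → Fin d
  index v = proj₂ (remQuot {2 * k} d v)

  recombine : ∀ v → combine (combine (side v) (class v)) (index v) ≡ v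
  recombine v = trans (cong (λ q → combine q (index v)) (Fin.combine-remQuot {2} k _))
                      (Fin.combine-remQuot {2 * k} d v)

  vertex-≡ : ∀ {u v} → side u ≡ side v → class u ≡ class v → index u ≡ index v → u ≡ v
  vertex-≡ {u} {v} s c i = begin
    u                                                 ≡⟨ recombine u ⟨
    combine (combine (side u) (class u)) (index u)    ≡⟨ cong₂ combine (cong₂ combine s c) i ⟩
    combine (combine (side v) (class v)) (index v)    ≡⟨ recombine v ⟩
    v                                                 ∎
    where open ≡-Reasoning

  -- The first component is a palette: `zero` for edges between the sides, `suc u` for edges inside
  -- a side with earlier endpoint `u`. The second picks one of the `k` colors of the palette.
  Label : Set
  Label = Fin (suc n) × Fin k

  label : Fin n → Fin n → Label
  label u v with side u Fin.≟ side v | u Fin.≤? v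
  ... | no  _ | _     = zero , latin k (class u) (class v)
  -- The diagonal falls under this case; its value carries no meaning.
  ... | yes _ | yes _ = suc u , class v
  ... | yes _ | no  _ = suc v , class u

  label-sym : ∀ u v → label u v ≡ label v u
  label-sym u v with side u Fin.≟ side v | side v Fin.≟ side u | u Fin.≤? v | v Fin.≤? u
  ... | no  _   | no  _   | _       | _       = cong (zero ,_) (latin-comm k (class u) (class v))
  ... | no  u≁v | yes v∼u | _       | _       = contradiction (sym v∼u) u≁v
  ... | yes u∼v | no  v≁u | _       | _       = contradiction (sym u∼v) v≁u
  ... | yes _   | yes _   | yes _   | no  _   = refl
  ... | yes _   | yes _   | no  _   | yes _   = refl
  ... | yes _   | yes _   | yes u≤v | yes v≤u with refl ← Fin.≤-antisym u≤v v≤u = refl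
  ... | yes _   | yes _   | no  u≰v | no  v≰u =
    contradiction (ℕ.<⇒≤ (ℕ.≰⇒> u≰v)) v≰u

  label-cross : ∀ {u v} → side u ≢ side v → label u v ≡ (zero , latin k (class u) (class v))
  label-cross {u} {v} u≁v with side u Fin.≟ side v
  ... | yes u∼v = contradiction u∼v u≁v
  ... | no  _   = refl

  label-< : ∀ {u v} → side u ≡ side v → u Fin.< v → label u v ≡ (suc u , class v)
  label-< {u} {v} u∼v u<v with side u Fin.≟ side v | u Fin.≤? v
  ... | no  u≁v | _       = contradiction u∼v u≁v
  ... | yes _   | yes _   = refl
  ... | yes _   | no  u≰v = contradiction (ℕ.<⇒≤ u<v) u≰v

  -- A view of the three kinds of edges, so that two edges at `u` can be compared by cases without
  -- unfolding `label`.
  data Edge (u v : Fin n) : Label → Set where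
    across : side u ≢ side v → Edge u v (zero , latin k (class u) (class v))
    above  : side u ≡ side v → u Fin.< v → Edge u v (suc u , class v)
    below  : side u ≡ side v → v Fin.< u → Edge u v (suc v , class u)

  edge : ∀ {u v} → u ≢ v → Edge u v (label u v)
  edge {u} {v} u≢v = go (side u Fin.≟ side v) (Fin.<-cmp u v)
    where
    go : Dec (side u ≡ side v) → Tri (u Fin.< v) (u ≡ v) (v Fin.< u) → Edge u v (label u v)
    go (no  u≁v) _              = subst (Edge u v) (sym (label-cross u≁v)) (across u≁v)
    go (yes u∼v) (tri< u<v _ _) = subst (Edge u v) (sym (label-< u∼v u<v)) (above u∼v u<v)
    go (yes _)   (tri≈ _ eq _)  = contradiction eq u≢v
    go (yes u∼v) (tri> _ _ v<u) =
      subst (Edge u v) (sym (trans (label-sym u v) (label-< (sym u∼v) v<u))) (below u∼v v<u)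

  -- Since `index` takes only d values, every color has degree at most d at u.
  edge-unique : ∀ {u v w x y} → Edge u v x → Edge u w y → x ≡ y → index v ≡ index w → v ≡ w
  edge-unique {u} (across u≁v) (across u≁w) eq =
    vertex-≡ (Fin2-≢ u≁v u≁w) (latin-cancelˡ k (class u) (,-injectiveʳ eq))
  edge-unique (above u∼v _) (above u∼w _) eq = vertex-≡ (trans (sym u∼v) u∼w) (,-injectiveʳ eq)
  edge-unique (below _ _) (below _ _) eq _ = Fin.suc-injective (,-injectiveˡ eq)
  edge-unique (above _ _) (below _ w<u) eq _ =
    contradiction (sym (Fin.suc-injective (,-injectiveˡ eq))) (Fin.<⇒≢ w<u)
  edge-unique (below _ v<u) (above _ _) eq _ =
    contradiction (Fin.suc-injective (,-injectiveˡ eq)) (Fin.<⇒≢ v<u)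

  module _ {ℓ : ℕ} (enough : suc n * k ≤ ℓ) where

    encode : Label → Fin ℓ
    encode (i , j) = inject≤ (combine i j) enough

    encode-injective : Injective _≡_ _≡_ encode
    encode-injective {i , j} {i′ , j′} eq
      with refl , refl ← Fin.combine-injective i j i′ j′ (Fin.inject≤-injective enough enough _ _ eq)
      = refl

    extremal : Coloring n ℓ
    extremal = record
      { color     = λ u v → encode (label u v)
      ; color-sym = λ u v → cong encode (label-sym u v)
      }

    -- Among `suc d` leaves two share one of the `d` indices; joined to the centre in the same
    -- color, they coincide by `edge-unique`.
    extremal-starless : ¬ HasMonochromaticCopy (Star (suc d)) extremal
    extremal-starless (x , f , inj , mono)
      with i , j , i<j , eq ← Fin.pigeonhole (ℕ.n<1+n d) (index ∘ f ∘ suc)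
      = Fin.<⇒≢ i<j (Fin.suc-injective (inj (edge-unique (edge (centre≢ i)) (edge (centre≢ j))
          (encode-injective (trans (spoke i) (sym (spoke j)))) eq)))
      where
      centre≢ : ∀ j → f zero ≢ f (suc j)
      centre≢ j eq = Fin.0≢1+n (inj eq)

      spoke : ∀ j → encode (label (f zero) (f (suc j))) ≡ x
      spoke j = mono zero (suc j) (inj₁ (refl , λ ()))

    extremal-gallai : IsGallai k extremal
    extremal-gallai S 2≤∣S∣ with least S nonempty
      where
      nonempty : Nonempty S
      nonempty with Subset.nonempty? S
      ... | yes ne = ne
      ... | no  ¬ne = contradiction
        (subst (2 ≤_) (trans (cong ∣_∣ (Subset.Empty-unique ¬ne)) (Subset.∣⊥∣≡0 n)) 2≤∣S∣) λ ()
    ... | i , i∈S , i≤ with Fin.any? (λ v → v Subset.∈? S ×-dec ¬? (side i Fin.≟ side v))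
    -- `S` meets both sides, and only palette `zero` crosses between them.
    ... | yes (v , v∈S , i≁v) =
      bipartition extremal side i∈S v∈S i≁v (λ j → encode (zero , j))
        (λ _ _ u≁v → _ , cong encode (sym (label-cross u≁v)))
    ... | no one-sided with Fin.any? (λ v → v Subset.∈? S ×-dec ¬? (v Fin.≟ i))
    ... | no S⊆i = contradiction (ℕ.≤-trans 2≤∣S∣ (ℕ.≤-trans (Subset.p⊆q⇒∣p∣≤∣q∣ S⊆⁅i⁆)
                     (ℕ.≤-reflexive (Subset.∣⁅x⁆∣≡1 i)))) λ { (s≤s ()) }
      where
      S⊆⁅i⁆ : ∀ {v} → v ∈ S → v ∈ ⁅ i ⁆
      S⊆⁅i⁆ {v} v∈S with v Fin.≟ i
      ... | yes refl = Subset.x∈⁅x⁆ i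
      ... | no  v≢i  = contradiction (v , v∈S , v≢i) S⊆i
    -- `S` lies in one side. When its least vertex `i` is split off, every crossing edge has `i` as
    -- its earlier endpoint, so only palette `suc i` appears.
    ... | yes (w , w∈S , w≢i) =
      bipartition extremal part i∈S w∈S i≁w (λ j → encode (suc i , j)) cross
      where
      part : Fin n → Fin 2
      part v with v Fin.≟ i
      ... | yes _ = zero
      ... | no  _ = suc zero

      i≁w : part i ≢ part w
      i≁w with i Fin.≟ i | w Fin.≟ i
      ... | no i≢i | _       = contradiction refl i≢i
      ... | yes _  | yes w≡i = contradiction w≡i w≢i
      ... | yes _  | no _    = λ ()

      same-side : ∀ {v} → v ∈ S → side i ≡ side v
      same-side {v} v∈S with side i Fin.≟ side v
      ... | yes i∼v = i∼v
      ... | no  i≁v = contradiction (v , v∈S , i≁v) one-sided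

      label-least : ∀ {v} → v ∈ S → v ≢ i → label i v ≡ (suc i , class v)
      label-least v∈S v≢i = label-< (same-side v∈S) (Fin.≤∧≢⇒< (i≤ v∈S) (v≢i ∘ sym))

      cross : ∀ {u v} → u ∈ S → v ∈ S → part u ≢ part v →
              ∃[ j ] encode (suc i , j) ≡ encode (label u v)
      cross {u} {v} u∈S v∈S u≁v with u Fin.≟ i | v Fin.≟ i
      ... | yes _    | yes _    = contradiction refl u≁v
      ... | no  _    | no  _    = contradiction refl u≁v
      ... | yes refl | no  v≢i  = class v , cong encode (sym (label-least v∈S v≢i))
      ... | no  u≢i  | yes refl =
        class u , cong encode (sym (trans (label-sym u i) (label-least u∈S u≢i)))

proposition1 : ∀ (k t : ℕ) → 2 ≤ k → 2 ≤ t →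
    ∃[ ℓ₀ ] (∀ (ℓ : ℕ) → ℓ₀ ≤ ℓ → IsGGR k ℓ (Star t) (2 * k * (t ∸ 1) + 1))
-- The threshold `suc n * k` is the number of labels: `suc n` palettes of `k` colors. From there on
-- the labels embed into `Fin ℓ`.
proposition1 k@(suc _) (suc d) 2≤k (s≤s 1≤d) = suc n * k , λ ℓ enough →
  forces-star k d ℓ (ℕ.≤-trans (s≤s z≤n) 2≤k) 1≤d ,
  -- A forcing number `M ≤ n` would apply to the extremal coloring on `n` vertices.
  λ M forces → ℕ.≮⇒≥ λ M<N → extremal-starless enough
    (forces n (ℕ.m<1+n⇒m≤n (subst (M <_) (ℕ.+-comm n 1) M<N))
      (extremal enough) (extremal-gallai enough))
  where open Extremal k d
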